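{- Let $(G;+,\cdot)$ be a finite field of order $q$. Then the class of affine functions of arity at least $\max(q,3)+1$ over $(G;+,\cdot)$ is reconstructible: for every $n \geq \max(q,3)+1$, every affine $f\colon G^n\to G$ and every function $g \colon G^n \to G$ (not assumed affine) with $\operatorname{deck} g = \operatorname{deck} f$, we have $g \equiv f$.
   Context: A function $f\colon G^n\to G$ is affine if $f(x_1,\dots,x_n) = a_1x_1+\dots+a_nx_n+c$ for some $a_i,c\in G$. Identification minor: for $f\colon A^n\to B$ and $I=\{i,j\}$, $i<j$, $f_I\colon A^{n-1}\to B$ is $f_I(x_1,\dots,x_{n-1}) = f(x_1,\dots,x_{j-1},x_i,x_j,\dots,x_{n-1})$. Two functions $f,g\colon A^n\to B$ are equivalent, $f\equiv g$, if $f(x_1,\dots,x_n) = g(x_{\sigma(1)},\dots,x_{\sigma(n)})$ for some permutation $\sigma$ of $\{1,\dots,n\}$. The deck of $f$ is the multiset $\langle f_I/{\equiv} : I\rangle$ of equivalence classes of all $\binom n2$ identification minors of $f$. -}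

module Defs where

open import Algebra.Apartness.Structures using (IsHeytingField)
open import Data.Fin using (Fin; Fin′; inject!)
open import Data.Fin.Permutation using (Permutation′; _⟨$⟩ʳ_)
open import Data.Nat using (ℕ; suc)
open import Data.Product using (Σ; ∃; ∃₂; _,_)
open import Data.Vec using (Vec; foldr′; insertAt; lookup; tabulate; zipWith)
open import Function.Bundles using (_↔_; Inverse)
open import Level using (Level)
open import Relation.Binary.PropositionalEquality using (_≡_; _≢_)

private
  variable
    a b : Level
    A : Set a
    B : Set b
    n : ℕ

-- Equality on a finite set is decidable, so a Heyting field whose apartness
-- is _≢_ is a field in the ordinary sense: a commutative ring in which x is
-- invertible exactly when x ≢ 0# (in particular 0# ≢ 1#).
record FiniteField c (q : ℕ) : Set (Level.suc c) where
  infixl 6 _+_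
  infixl 7 _*_
  infix  8 -_
  field
    Carrier        : Set c
    _+_ _*_        : Carrier → Carrier → Carrier
    -_             : Carrier → Carrier
    0# 1#          : Carrier
    isHeytingField : IsHeytingField _≡_ _≢_ _+_ _*_ -_ 0# 1#
    enumeration    : Carrier ↔ Fin q

-- Arguments are tuples (vectors), so propositional equality of arguments is
-- equality of tuples; functions themselves are only ever compared pointwise.
Fun : Set a → Set b → ℕ → Set _
Fun A B n = Vec A n → B

infix 4 _≋_ _≈deck_

_≋_ : Fun A B n → Fun A B n → Set _
_≋_ {n = n} f g =
  ∃ λ (σ : Permutation′ n) → ∀ xs → f xs ≡ g (tabulate λ k → lookup xs (σ ⟨$⟩ʳ k))

-- The two-element subsets {i , j} of Fin n, written (j , i) with i < j.
Pair : ℕ → Set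
Pair n = Σ (Fin n) Fin′

-- inject! i is i itself as an index into the shorter tuple, which is
-- legitimate because i < j; x_i is inserted so as to become the j-th entry.
minor : Fun A B (suc n) → Pair (suc n) → Fun A B n
minor f (j , i) xs = f (insertAt xs j (lookup xs (inject! i)))

-- deck f = deck g. The decks are the multisets of ≋-classes of the finite
-- families minor f and minor g, both indexed by Pair; they are equal when some
-- bijection of the indices matches the members up to ≋.
_≈deck_ : Fun A B (suc n) → Fun A B (suc n) → Set _
_≈deck_ {n = n} f g =
  ∃ λ (π : Pair (suc n) ↔ Pair (suc n)) → ∀ I → minor f I ≋ minor g (Inverse.to π I)

module _ {c} {q : ℕ} (F : FiniteField c q) where
  open FiniteField F

  Affine : Fun Carrier Carrier n → Set c
  Affine {n} f = ∃₂ λ (as : Vec Carrier n) (k : Carrier) →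
    ∀ xs → f xs ≡ foldr′ _+_ 0# (zipWith _*_ as xs) + k

{-# OPTIONS --safe #-}
module Submission where

-- On each diagonal x_p = x_r the function g coincides with an affine function,
-- since a minor of g is a permuted minor of f. As the arity N exceeds q, the
-- diagonals cover the whole space, and as N ≥ 4, the unit vectors and their
-- pairwise sums lie on enough diagonals to force the affine functions to agree:
-- g is affine, with coefficients b, say, while f has coefficients a.
--
-- Put Δ φ = Σ φ(a_l) − Σ φ(b_l) for φ : G → ℤ. Summing φ over the coefficients
-- of all minors gives
--   (N−1)(N−2) Δ φ + Σ_v Δ (φ (– + a_v)) + Σ_v Δ (φ (– + b_v)) = Δ (φ (2 –)).
-- For N ≥ 5 the factor (N−1)(N−2) exceeds the number 2N+1 of the other terms, so
-- a bound K+1 for |Δ φ|, uniform in φ : G → {0,1}, improves to K and eventually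
-- to 0. Hence every element occurs equally often in a and b. For N = 4 the field
-- has two or three elements, and the equation together with Σ a_l = Σ b_l
-- determines the occurrences; this is checked exhaustively in ℤ/2 and ℤ/3.

open import Defs
open import Algebra.Apartness.Structures using (IsHeytingField)
open import Algebra.Bundles using (AbelianGroup; CommutativeRing)
open import Algebra.Core using (Op₂)
open import Algebra.Definitions using (Commutative)
import Algebra.Properties.Group as GroupProperties
import Algebra.Properties.Ring as RingProperties
import Algebra.Properties.Semiring.Sum as SemiringSum
open import Data.Bool using (Bool; true; false; if_then_else_)
open import Data.Fin using (Fin; zero; suc; _≟_; inject!; punchIn; punchOut; splitAt; toℕ)
open import Data.Fin.Patterns using (0F; 1F; 2F; 3F)
open import Data.Fin.Permutation using (Permutation′; _⟨$⟩ʳ_; insert; insert-punchIn)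
import Data.Fin.Permutation as Permutation
open import Data.Fin.Properties
  using (all?; any?; pigeonhole; punchIn-punchOut; punchInᵢ≢i; +↔⊎; ¬∀⟶∃¬)
import Data.Fin.Properties as Fin
open import Data.Integer as ℤ using (ℤ)
import Data.Integer.Properties as ℤ
open import Data.Integer.Tactic.RingSolver using () renaming (solve-∀ to ℤ-solve-∀)
open import Data.Nat as ℕ using (ℕ; zero; suc)
open import Data.Nat.DivMod using (_mod_)
import Data.Nat.Properties as ℕ
open import Data.Nat.Tactic.RingSolver using () renaming (solve-∀ to ℕ-solve-∀)
open import Data.Product using (∃; ∃₂; _×_; _,_; proj₁; proj₂)
open import Data.Sum using (_⊎_; inj₁; inj₂; map₁; map₂)
open import Data.Sum.Function.Propositional using (_⊎-↔_)
open import Data.Vec as Vec using (Vec; []; _∷_; foldr′; lookup; tabulate; zipWith)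
open import Data.Vec.Functional using (foldr; insertAt)
open import Data.Vec.Functional.Properties using (insertAt-lookup; insertAt-punchIn)
open import Data.Vec.Properties using (lookup∘tabulate; tabulate∘lookup; tabulate-cong)
import Data.Vec.Properties as Vec
open import Function using (_∘_; _↔_; id; mk↔ₛ′; Injection; Injective; Inverse)
open import Function.Properties.Inverse using (↔-refl; ↔-sym; ↔-trans; ↔⇒↣)
open import Relation.Binary.Definitions using (DecidableEquality)
open import Relation.Binary.PropositionalEquality as ≡
  using (_≡_; _≢_; _≗_; module ≡-Reasoning)
open import Relation.Nullary using (¬_; Dec; does; yes; no; contradiction)
open import Relation.Nullary.Decidable using (dec-true; dec-false; from-yes; via-injection; _→-dec_)

private module ℤΣ = SemiringSum ℤ.+-*-semiring

-- Affine functions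

-- If every `s` had a preimage, choosing one would map `Fin n` into the smaller `Fin k`, and by
-- `pigeonhole` two different `s` would share a preimage. It supplies coordinates away from a given
-- diagonal.
fresh : ∀ {k n} → k ℕ.< n → (v : Fin k → Fin n) → ∃ λ s → ∀ i → v i ≢ s
fresh {k} {n} k<n v with ¬∀⟶∃¬ n (λ s → ∃ λ i → v i ≡ s) (λ s → any? λ i → v i ≟ s) not-onto
  where
  not-onto : ¬ (∀ s → ∃ λ i → v i ≡ s)
  not-onto onto with i , j , i<j , eq ← pigeonhole k<n (proj₁ ∘ onto) =
    Fin.<⇒≢ i<j (≡.trans (≡.sym (proj₂ (onto i))) (≡.trans (≡.cong v eq) (proj₂ (onto j))))
... | s , s∉v = s , λ i eq → s∉v (i , eq)

module Linear {ℓ₁ ℓ₂} (R : CommutativeRing ℓ₁ ℓ₂) where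
  open CommutativeRing R hiding (zero)
  open SemiringSum semiring
  open GroupProperties +-group using (∙-cancelʳ)
  open import Relation.Binary.Reasoning.Setoid setoid

  sum-support : ∀ {n} (t : Fin n → Carrier) p → (∀ l → p ≢ l → t l ≈ 0#) → sum t ≈ t p
  sum-support {suc n} t p vanish = begin
    sum t                            ≈⟨ sum-remove t ⟩
    t p + sum (t ∘ punchIn p)        ≈⟨ +-congˡ (sum-cong-≋ {n} λ l → vanish _ (punchInᵢ≢i p l ∘ ≡.sym)) ⟩
    t p + sum {n} (λ _ → 0#)         ≈⟨ +-congˡ (sum-replicate-zero n) ⟩
    t p + 0#                         ≈⟨ +-identityʳ _ ⟩
    t p                              ∎

  δ : ∀ {n} → Fin n → Fin n → Carrier
  δ p l = if does (p ≟ l) then 1# else 0#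

  δ-refl : ∀ {n} (p : Fin n) → δ p p ≡ 1#
  δ-refl p rewrite dec-true (p ≟ p) ≡.refl = ≡.refl

  δ-≢ : ∀ {n} {p l : Fin n} → p ≢ l → δ p l ≡ 0#
  δ-≢ {p = p} {l} p≢l rewrite dec-false (p ≟ l) p≢l = ≡.refl

  δ-sym : ∀ {n} (p l : Fin n) → δ p l ≡ δ l p
  δ-sym p l with p ≟ l
  ... | yes ≡.refl = ≡.sym (δ-refl p)
  ... | no p≢l     = ≡.sym (δ-≢ (p≢l ∘ ≡.sym))

  infix 8 _∙_
  _∙_ : ∀ {n} → (Fin n → Carrier) → (Fin n → Carrier) → Carrier
  a ∙ x = sum λ k → a k * x k

  ∙-congˡ′ : ∀ {n} {a b : Fin n → Carrier} x → (∀ k → a k ≈ b k) → a ∙ x ≈ b ∙ x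
  ∙-congˡ′ x a≈b = sum-cong-≋ λ k → *-congʳ (a≈b k)

  ∙-congʳ′ : ∀ {n} (a : Fin n → Carrier) {x y} → (∀ k → x k ≈ y k) → a ∙ x ≈ a ∙ y
  ∙-congʳ′ a x≈y = sum-cong-≋ λ k → *-congˡ (x≈y k)

  ∙-0 : ∀ {n} (a : Fin n → Carrier) → a ∙ (λ _ → 0#) ≈ 0#
  ∙-0 {n} a = trans (sum-cong-≋ λ k → zeroʳ (a k)) (sum-replicate-zero n)

  ∙-δ : ∀ {n} (a : Fin n → Carrier) p → a ∙ δ p ≈ a p
  ∙-δ a p = begin
    a ∙ δ p      ≈⟨ sum-support _ p (λ l p≢l → trans (*-congˡ (reflexive (δ-≢ p≢l))) (zeroʳ _)) ⟩
    a p * δ p p  ≈⟨ *-congˡ (reflexive (δ-refl p)) ⟩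
    a p * 1#     ≈⟨ *-identityʳ _ ⟩
    a p          ∎

  ∙-+ : ∀ {n} (a x y : Fin n → Carrier) → a ∙ (λ k → x k + y k) ≈ a ∙ x + a ∙ y
  ∙-+ {n} a x y = trans (sum-cong-≋ {n} λ k → distribˡ _ _ _) (∑-distrib-+ (λ k → a k * x k) λ k → a k * y k)

  ∙-comm : ∀ {n} (a x : Fin n → Carrier) → a ∙ x ≈ x ∙ a
  ∙-comm {n} a x = sum-cong-≋ {n} λ k → *-comm _ _

  -- Entry `l` adds up `a` over the fibre of `ρ` above `l`: when variables are identified, their
  -- coefficients are added.
  pushforward : ∀ {m n} → (Fin m → Fin n) → (Fin m → Carrier) → Fin n → Carrier
  pushforward ρ a l = a ∙ (δ l ∘ ρ)

  -- Precomposition with `ρ` and pushforward along `ρ` are adjoint: expand `x (ρ k)` in unit vectors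
  -- and exchange the two sums.
  ∙-pushforward : ∀ {m n} (ρ : Fin m → Fin n) a x → a ∙ (x ∘ ρ) ≈ pushforward ρ a ∙ x
  ∙-pushforward {m} {n} ρ a x = begin
    sum (λ k → a k * x (ρ k))
      ≈⟨ sum-cong-≋ (λ k → *-congˡ (begin
           x (ρ k)                      ≈⟨ ∙-δ x (ρ k) ⟨
           sum (λ l → x l * δ (ρ k) l)  ≈⟨ sum-cong-≋ (λ l → trans (*-comm _ _) (*-congʳ (reflexive (δ-sym (ρ k) l)))) ⟩
           sum (λ l → δ l (ρ k) * x l)  ∎)) ⟩
    sum (λ k → a k * sum (λ l → δ l (ρ k) * x l))
      ≈⟨ sum-cong-≋ (λ k → *-distribˡ-sum (a k) (λ l → δ l (ρ k) * x l)) ⟩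
    sum (λ k → sum λ l → a k * (δ l (ρ k) * x l))
      ≈⟨ ∑-comm (λ k l → a k * (δ l (ρ k) * x l)) ⟩
    sum (λ l → sum λ k → a k * (δ l (ρ k) * x l))
      ≈⟨ sum-cong-≋ (λ l → trans (sum-cong-≋ {m} λ k → sym (*-assoc _ _ _))
                                 (sym (*-distribʳ-sum (x l) λ k → a k * δ l (ρ k)))) ⟩
    pushforward ρ a ∙ x ∎

  -- Functions that are affine on every diagonal

  module _ {n} (3<n : 3 ℕ.< n) (g : (Fin n → Carrier) → Carrier)
           (g-affine : ∀ {p q} → p ≢ q → ∃₂ λ c d → ∀ x → x p ≈ x q → g x ≈ c ∙ x + d) where
    private
      d₀ : Carrier
      d₀ = g (λ _ → 0#)

      -- The values at zero and at the unit vectors leave no other candidates for the constant and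
      -- the coefficients of `g`.
      b : Fin n → Carrier
      b l = g (δ l) - d₀

      module _ {p q : Fin n} (p≢q : p ≢ q) where
        coefficient : Fin n → Carrier
        coefficient = proj₁ (g-affine p≢q)

        -- The zero vector lies on every diagonal, so the constants on all diagonals are the value
        -- of `g` there.
        affine-d₀ : ∀ x → x p ≈ x q → g x ≈ coefficient ∙ x + d₀
        affine-d₀ x xp≈xq = trans (proj₂ (proj₂ (g-affine p≢q)) x xp≈xq) (+-congˡ (sym (begin
          d₀                                 ≈⟨ proj₂ (proj₂ (g-affine p≢q)) (λ _ → 0#) refl ⟩
          coefficient ∙ (λ _ → 0#) + d       ≈⟨ +-congʳ (∙-0 coefficient) ⟩
          0# + d                             ≈⟨ +-identityˡ _ ⟩
          d                                  ∎)))
          where d = proj₁ (proj₂ (g-affine p≢q))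

        -- The unit vector `δ l` lies on the diagonal of `p` and `q` once `l` is neither of them, so
        -- `g (δ l)` determines this coefficient.
        coefficient≈b : ∀ {l} → l ≢ p → l ≢ q → coefficient l ≈ b l
        coefficient≈b {l} l≢p l≢q = sym (begin
          g (δ l) - d₀             ≈⟨ +-congʳ (affine-d₀ (δ l) (reflexive (≡.trans (δ-≢ l≢p) (≡.sym (δ-≢ l≢q))))) ⟩
          coefficient ∙ δ l + d₀ - d₀ ≈⟨ +-assoc _ _ _ ⟩
          coefficient ∙ δ l + (d₀ - d₀) ≈⟨ +-cong (∙-δ _ l) (-‿inverseʳ d₀) ⟩
          coefficient l + 0#       ≈⟨ +-identityʳ _ ⟩
          coefficient l            ∎)

        g-δ+δ : ∀ {l m} → δ l p + δ m p ≈ δ l q + δ m q →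
                g (λ k → δ l k + δ m k) ≈ coefficient l + coefficient m + d₀
        g-δ+δ {l} {m} eq = begin
          g (λ k → δ l k + δ m k)                    ≈⟨ affine-d₀ _ eq ⟩
          coefficient ∙ (λ k → δ l k + δ m k) + d₀   ≈⟨ +-congʳ (∙-+ _ (δ l) (δ m)) ⟩
          coefficient ∙ δ l + coefficient ∙ δ m + d₀ ≈⟨ +-congʳ (+-cong (∙-δ _ l) (∙-δ _ m)) ⟩
          coefficient l + coefficient m + d₀         ∎

    -- On the diagonal only the sum of the coefficients at `p` and `q` matters, and by `cp+cq` this
    -- sum is the same for `c` and `b`. Elsewhere the two agree, so `b` arises from `c` by moving
    -- the amount `s` from position `p` to position `q`.
    affine-on-diagonals : ∀ {p q} → p ≢ q → ∀ x → x p ≈ x q → g x ≈ b ∙ x + d₀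
    affine-on-diagonals {p} {q} p≢q x xp≈xq = trans (affine-d₀ p≢q x xp≈xq) (+-congʳ (∙-cancelʳ (s * x q) _ _ (begin
      c ∙ x + s * x q                     ≈⟨ extend c q ⟨
      (λ l → c l + s * δ q l) ∙ x         ≈⟨ ∙-congˡ′ x shift ⟩
      (λ l → b l + s * δ p l) ∙ x         ≈⟨ extend b p ⟩
      b ∙ x + s * x p                     ≈⟨ +-congˡ (*-congˡ xp≈xq) ⟩
      b ∙ x + s * x q                     ∎)))
      where
      c : Fin n → Carrier
      c = coefficient p≢q
      s : Carrier
      s = c p - b p

      extend : ∀ (e : Fin n → Carrier) r → (λ l → e l + s * δ r l) ∙ x ≈ e ∙ x + s * x r
      extend e r = begin
        sum (λ l → (e l + s * δ r l) * x l)              ≈⟨ sum-cong-≋ {n} (λ l → trans (distribʳ _ _ _) (+-congˡ (*-assoc _ _ _))) ⟩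
        sum (λ l → e l * x l + s * (δ r l * x l))        ≈⟨ ∑-distrib-+ (λ l → e l * x l) (λ l → s * (δ r l * x l)) ⟩
        e ∙ x + sum (λ l → s * (δ r l * x l))            ≈⟨ +-congˡ (*-distribˡ-sum s (λ l → δ r l * x l)) ⟨
        e ∙ x + s * (δ r ∙ x)                            ≈⟨ +-congˡ (*-congˡ (trans (∙-comm (δ r) x) (∙-δ x r))) ⟩
        e ∙ x + s * x r                                  ∎

      -- δ p + δ q also lies on the diagonal x r = x t for r, t outside {p , q}.
      cp+cq : c p + c q ≈ b p + b q
      cp+cq with fresh (ℕ.<-trans (ℕ.n<1+n 2) 3<n) (λ { zero → p ; (suc _) → q })
      ... | r , r∉ with fresh 3<n (λ { zero → p ; (suc zero) → q ; (suc (suc _)) → r })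
      ... | t , t∉ = ∙-cancelʳ d₀ _ _ (begin
        c p + c q + d₀               ≈⟨ g-δ+δ p≢q (trans (+-cong (reflexive (δ-refl p)) (reflexive (δ-≢ (p≢q ∘ ≡.sym))))
                                         (trans (+-comm _ _) (sym (+-cong (reflexive (δ-≢ p≢q)) (reflexive (δ-refl q)))))) ⟨
        g (λ k → δ p k + δ q k)      ≈⟨ g-δ+δ r≢t (+-cong (reflexive (≡.trans (δ-≢ (r∉ zero)) (≡.sym (δ-≢ (t∉ zero)))))
                                                           (reflexive (≡.trans (δ-≢ (r∉ (suc zero))) (≡.sym (δ-≢ (t∉ (suc zero))))))) ⟩
        coefficient r≢t p + coefficient r≢t q + d₀
          ≈⟨ +-congʳ (+-cong (coefficient≈b r≢t (r∉ zero) (t∉ zero)) (coefficient≈b r≢t (r∉ (suc zero)) (t∉ (suc zero)))) ⟩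
        b p + b q + d₀               ∎)
        where
        r≢t : r ≢ t
        r≢t = t∉ (suc (suc zero))

      shift : ∀ l → c l + s * δ q l ≈ b l + s * δ p l
      shift l with p ≟ l | q ≟ l
      ... | yes ≡.refl | yes ≡.refl = contradiction ≡.refl p≢q
      ... | yes ≡.refl | no _ = begin
        c p + s * 0#             ≈⟨ trans (+-congˡ (zeroʳ s)) (+-identityʳ _) ⟩
        c p                      ≈⟨ trans (+-congˡ (-‿inverseˡ (b p))) (+-identityʳ _) ⟨
        c p + (- b p + b p)      ≈⟨ +-assoc _ _ _ ⟨
        s + b p                  ≈⟨ +-comm _ _ ⟩
        b p + s                  ≈⟨ +-congˡ (*-identityʳ s) ⟨
        b p + s * 1#             ∎
      ... | no _ | yes ≡.refl = begin
        c q + s * 1#             ≈⟨ +-congˡ (*-identityʳ s) ⟩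
        c q + (c p - b p)        ≈⟨ +-assoc _ _ _ ⟨
        c q + c p - b p          ≈⟨ +-congʳ (trans (+-comm _ _) cp+cq) ⟩
        b p + b q - b p          ≈⟨ +-congʳ (+-comm _ _) ⟩
        b q + b p - b p          ≈⟨ +-assoc _ _ _ ⟩
        b q + (b p - b p)        ≈⟨ +-congˡ (-‿inverseʳ _) ⟩
        b q + 0#                 ≈⟨ +-congˡ (zeroʳ s) ⟨
        b q + s * 0#             ∎
      ... | no p≢l | no q≢l = +-congʳ (coefficient≈b p≢q (p≢l ∘ ≡.sym) (q≢l ∘ ≡.sym))

    affine-from-diagonals : (∀ x → ∃₂ λ p q → p ≢ q × x p ≈ x q) → ∃₂ λ b d → ∀ x → g x ≈ b ∙ x + d
    affine-from-diagonals repeats = b , d₀ , λ x →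
      let p , q , p≢q , xp≈xq = repeats x in affine-on-diagonals p≢q x xp≈xq

-- Sums over pairs and over multisets

open ≡ using (refl; sym; trans; cong; cong₂; subst)

module _ where
  open import Data.Integer using (_+_; _*_; _-_; -_; +_; ∣_∣)
  open ℤΣ
  open GroupProperties (AbelianGroup.group ℤ.+-0-abelianGroup) using () renaming (∙-cancelˡ to +-cancelˡ)

  -- Pairs are split by whether their smaller element is `zero`.
  Pair-suc : ∀ n → Pair (suc n) ↔ (Fin n ⊎ Pair n)
  Pair-suc n = mk↔ₛ′ to from
    (λ { (inj₁ _) → refl ; (inj₂ _) → refl })
    (λ { (zero , ()) ; (suc _ , zero) → refl ; (suc _ , suc _) → refl })
    where
    to : Pair (suc n) → Fin n ⊎ Pair n
    to (suc j , zero)  = inj₁ j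
    to (suc j , suc i) = inj₂ (j , i)

    from : Fin n ⊎ Pair n → Pair (suc n)
    from (inj₁ j)       = suc j , zero
    from (inj₂ (j , i)) = suc j , suc i

  -- The binomial coefficient `n` over 2, by Pascal's rule.
  ∣Pair∣ : ℕ → ℕ
  ∣Pair∣ zero    = zero
  ∣Pair∣ (suc n) = n ℕ.+ ∣Pair∣ n

  Pair↔Fin : ∀ n → Pair n ↔ Fin (∣Pair∣ n)
  Pair↔Fin zero    = mk↔ₛ′ (λ { (() , _) }) (λ ()) (λ ()) (λ { (() , _) })
  Pair↔Fin (suc n) = ↔-trans (Pair-suc n) (↔-trans (↔-refl ⊎-↔ Pair↔Fin n) (↔-sym +↔⊎))

  sumPairs : ∀ {n} → (Pair n → ℤ) → ℤ
  sumPairs {n} h = sum (h ∘ Inverse.from (Pair↔Fin n))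

  sumPairs-cong : ∀ {n} {h h′ : Pair n → ℤ} → h ≗ h′ → sumPairs h ≡ sumPairs h′
  sumPairs-cong {n} h≗h′ = sum-cong-≗ (h≗h′ ∘ Inverse.from (Pair↔Fin n))

  sumPairs-permute : ∀ {n} (h : Pair n → ℤ) (π : Pair n ↔ Pair n) →
                     sumPairs h ≡ sumPairs (h ∘ Inverse.to π)
  sumPairs-permute {n} h π = trans
    (sum-permute (h ∘ Inverse.from (Pair↔Fin n))
                 (↔-trans (↔-sym (Pair↔Fin n)) (↔-trans π (Pair↔Fin n))))
    (sum-cong-≗ {∣Pair∣ n} λ k → cong h
      (Inverse.strictlyInverseʳ (Pair↔Fin n) (Inverse.to π (Inverse.from (Pair↔Fin n) k))))

  sum-splitAt : ∀ m {n} (h : Fin m ⊎ Fin n → ℤ) →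
                sum (h ∘ splitAt m) ≡ sum (h ∘ inj₁) + sum (h ∘ inj₂)
  sum-splitAt zero    h = sym (ℤ.+-identityˡ _)
  sum-splitAt (suc m) h = trans
    (cong (λ z → h (inj₁ zero) + z) (sum-splitAt m (h ∘ map₁ suc)))
    (sym (ℤ.+-assoc (h (inj₁ zero)) _ _))

  sumPairs-suc : ∀ {n} (h : Pair (suc n) → ℤ) →
    sumPairs h ≡ sum {n} (λ j → h (suc j , zero)) + sumPairs (λ (j , i) → h (suc j , suc i))
  sumPairs-suc {n} h = trans
    (sum-cong-≗ {n ℕ.+ ∣Pair∣ n} λ k → cong h (step (splitAt n k)))
    (sum-splitAt n (h ∘ Inverse.from (Pair-suc n) ∘ map₂ (Inverse.from (Pair↔Fin n))))
    where
    step : ∀ s → Inverse.from (Pair-suc n) (Inverse.from (↔-refl ⊎-↔ Pair↔Fin n) s)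
                 ≡ Inverse.from (Pair-suc n) (map₂ (Inverse.from (Pair↔Fin n)) s)
    step (inj₁ _) = refl
    step (inj₂ _) = refl

  -- As `i` lies below `j`, `punchIn j` keeps its value and only enlarges the index set. In this
  -- form it fits the removal of entry `j` from a sum.
  smaller larger : ∀ {n} → Pair (suc n) → Fin (suc n)
  smaller (j , i) = punchIn j (inject! i)
  larger  (j , i) = j

  -- A symmetric matrix consists of two equal triangles and the diagonal; the induction strips the
  -- first row and column.
  sumPairs-double : ∀ {n} (H : Fin (suc n) → Fin (suc n) → ℤ) → (∀ u v → H u v ≡ H v u) →
    sumPairs (λ I → H (smaller I) (larger I)) + sumPairs (λ I → H (smaller I) (larger I)) + sum (λ u → H u u)
    ≡ sum (λ u → sum (H u))
  sumPairs-double {zero}  H H-sym = lemma (H zero zero)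
    where
    lemma : ∀ x → + 0 + + 0 + (x + + 0) ≡ x + + 0 + + 0
    lemma = ℤ-solve-∀
  sumPairs-double {suc n} H H-sym = begin
    P + P + D
      ≡⟨ cong (λ p → p + p + D) (sumPairs-suc (λ I → H (smaller I) (larger I))) ⟩
    (E + P′) + (E + P′) + (H zero zero + D′)
      ≡⟨ lemma E P′ (H zero zero) D′ ⟩
    H zero zero + E + (E + (P′ + P′ + D′))
      ≡⟨ cong (λ z → H zero zero + E + z) (cong₂ _+_ (sum-cong-≗ λ v → H-sym zero (suc v))
           (sumPairs-double (λ u v → H (suc u) (suc v)) (λ u v → H-sym (suc u) (suc v)))) ⟩
    H zero zero + E + (sum (λ u → H (suc u) zero) + sum (λ u → sum (λ v → H (suc u) (suc v))))
      ≡⟨ cong (λ z → H zero zero + E + z) (∑-distrib-+ (λ u → H (suc u) zero) (λ u → sum (λ v → H (suc u) (suc v)))) ⟨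
    sum (λ u → sum (H u)) ∎
    where
    open ≡-Reasoning
    P  = sumPairs (λ I → H (smaller I) (larger I))
    P′ = sumPairs {suc n} (λ I → H (suc (smaller I)) (suc (larger I)))
    D  = sum (λ u → H u u)
    D′ = sum (λ u → H (suc u) (suc u))
    E  = sum (λ v → H zero (suc v))

    lemma : ∀ e p h d → (e + p) + (e + p) + (h + d) ≡ h + e + (e + (p + p + d))
    lemma = ℤ-solve-∀

  sum-const : ∀ n x → sum {n} (λ _ → x) ≡ + n * x
  sum-const zero    x = refl
  sum-const (suc n) x = trans (cong (λ z → x + z) (sum-const n x)) (sym (ℤ.suc-* (+ n) x))

  sum-- : ∀ {n} (s t : Fin n → ℤ) → sum (λ k → s k - t k) ≡ sum s - sum t
  sum-- {zero}  s t = refl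
  sum-- {suc n} s t = trans (cong (λ z → s zero - t zero + z) (sum-- (s ∘ suc) (t ∘ suc)))
    (lemma (s zero) (t zero) (sum (s ∘ suc)) (sum (t ∘ suc)))
    where
    lemma : ∀ s₀ t₀ s′ t′ → s₀ - t₀ + (s′ - t′) ≡ s₀ + s′ - (t₀ + t′)
    lemma = ℤ-solve-∀

  ∣sum∣≤ : ∀ {n} (t : Fin n → ℤ) K → (∀ k → ∣ t k ∣ ℕ.≤ K) → ∣ sum t ∣ ℕ.≤ n ℕ.* K
  ∣sum∣≤ {zero}  t K ∣t∣≤K = ℕ.z≤n
  ∣sum∣≤ {suc n} t K ∣t∣≤K = ℕ.≤-trans (ℤ.∣i+j∣≤∣i∣+∣j∣ (t zero) _)
    (ℕ.+-mono-≤ (∣t∣≤K zero) (∣sum∣≤ (t ∘ suc) K (∣t∣≤K ∘ suc)))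

  sum-nonneg : ∀ {n} (t : Fin n → ℤ) → (∀ k → + 0 ℤ.≤ t k) → + 0 ℤ.≤ sum t
  sum-nonneg {zero}  t 0≤t = ℤ.≤-refl
  sum-nonneg {suc n} t 0≤t = ℤ.+-mono-≤ (0≤t zero) (sum-nonneg (t ∘ suc) (0≤t ∘ suc))

  -- Occurrences and permutations

  ⟦_⟧ : Bool → ℤ
  ⟦ true  ⟧ = + 1
  ⟦ false ⟧ = + 0

  module _ {c} {A : Set c} (_≟ᴬ_ : DecidableEquality A) where

    occurrences : ∀ {n} → A → (Fin n → A) → ℤ
    occurrences x a = sum λ k → ⟦ does (a k ≟ᴬ x) ⟧

    ⟦⟧-nonneg : ∀ p → + 0 ℤ.≤ ⟦ p ⟧
    ⟦⟧-nonneg true  = ℤ.+≤+ ℕ.z≤n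
    ⟦⟧-nonneg false = ℤ.+≤+ ℕ.z≤n

    find : ∀ {n} x (a : Fin n → A) → occurrences x a ≢ + 0 → ∃ λ k → a k ≡ x
    find {n} x a ≢0 with any? (λ k → a k ≟ᴬ x)
    ... | yes found = found
    ... | no absent = contradiction
      (trans (sum-cong-≗ λ k → cong ⟦_⟧ (dec-false (a k ≟ᴬ x) (absent ∘ (k ,_)))) (sum-replicate-zero n)) ≢0

    occurrences-head≢0 : ∀ {n} (a : Fin (suc n) → A) → occurrences (a zero) a ≢ + 0
    occurrences-head≢0 a occ≡0 with a zero ≟ᴬ a zero
    ... | no a₀≢a₀ = contradiction refl a₀≢a₀
    ... | yes _ = contradiction
      (ℤ.≤-trans (ℤ.+-monoʳ-≤ (+ 1) (sum-nonneg (λ l → ⟦ does (a (suc l) ≟ᴬ a zero) ⟧) λ l → ⟦⟧-nonneg _))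
                 (ℤ.≤-reflexive occ≡0))
                    λ { (ℤ.+≤+ ()) }

    -- The first entry of `a` occurs in `b`, say at `k`. Removing both entries keeps the counts
    -- equal, and `insert` extends the permutation of the remaining ones.
    occurrences⇒permutation : ∀ {n} (a b : Fin n → A) → (∀ x → occurrences x a ≡ occurrences x b) →
                              ∃ λ (σ : Permutation′ n) → ∀ k → a k ≡ b (σ ⟨$⟩ʳ k)
    occurrences⇒permutation {zero}  a b same = Permutation.id , λ ()
    occurrences⇒permutation {suc n} a b same
      with k , bk≡a₀ ← find (a zero) b (λ occ≡0 → occurrences-head≢0 a (trans (same (a zero)) occ≡0))
      = let σ , a∘suc≗ = occurrences⇒permutation (a ∘ suc) (b ∘ punchIn k) same-rest
        in insert zero k σ , λ
          { zero    → sym bk≡a₀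
          ; (suc l) → trans (a∘suc≗ l) (cong b (sym (insert-punchIn zero k σ l))) }
      where
      same-rest : ∀ x → occurrences x (a ∘ suc) ≡ occurrences x (b ∘ punchIn k)
      same-rest x = +-cancelˡ ⟦ does (a zero ≟ᴬ x) ⟧ _ _ (trans (same x) (trans
        (sum-remove {i = k} (λ l → ⟦ does (b l ≟ᴬ x) ⟧))
        (cong (λ y → ⟦ does (y ≟ᴬ x) ⟧ + occurrences x (b ∘ punchIn k)) bk≡a₀)))

  -- Sums over the cards of a multiset

  module Cards {c} {A : Set c} (_∙_ : Op₂ A) where

    total : ∀ {n} → (Fin n → A) → (A → ℤ) → ℤ
    total a φ = sum (φ ∘ a)

    -- The sum of φ over the multiset left when the u-th and v-th elements are
    -- replaced by their product.
    card : ∀ {n} → (Fin n → A) → (A → ℤ) → Fin n → Fin n → ℤ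
    card a φ u v = total a φ + φ (a u ∙ a v) - (φ (a u) + φ (a v))

    products : ∀ {n} → (Fin n → A) → (A → ℤ) → ℤ
    products a φ = sum λ u → sum λ v → φ (a u ∙ a v)

    -- Twice the sum of `φ` over the elements of all cards, by `sumPairs-card`, in a form without
    -- pairs. With `N` elements the factor `suc k * k` is (N-1)(N-2).
    deckTotal : ∀ {k} → (Fin (2 ℕ.+ k) → A) → (A → ℤ) → ℤ
    deckTotal {k} a φ = + (suc k ℕ.* k) * total a φ + products a φ - total a (λ x → φ (x ∙ x))

    -- The formula for `card` makes sense also for `u` equal to `v`, so it can be summed over the
    -- whole square, row by row, and the diagonal subtracted afterwards.
    sumPairs-card : Commutative _≡_ _∙_ → ∀ {k} (a : Fin (2 ℕ.+ k) → A) φ →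
      sumPairs (λ I → card a φ (smaller I) (larger I)) + sumPairs (λ I → card a φ (smaller I) (larger I)) ≡ deckTotal a φ
    sumPairs-card comm {k} a φ = begin
      P + P                                       ≡⟨ lemma₁ P D ⟩
      P + P + D - D                               ≡⟨ cong (_- D) (sumPairs-double (card a φ) card-sym) ⟩
      sum (λ u → sum (card a φ u)) - D            ≡⟨ cong₂ _-_ grid diagonal ⟩
      N * (N * T) + Q - (N * T + N * T) - (N * T + T₂ - (T + T)) ≡⟨ lemma₂ (+ k) T Q T₂ ⟩
      (+ 1 + + k) * + k * T + Q - T₂              ≡⟨ cong (λ κ → κ * T + Q - T₂) (ℤ.pos-* (suc k) k) ⟨
      deckTotal a φ                               ∎
      where
      open ≡-Reasoning
      N  = + 2 + + k
      P  = sumPairs (λ I → card a φ (smaller I) (larger I))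
      D  = sum (λ u → card a φ u u)
      T  = total a φ
      Q  = products a φ
      T₂ = total a (λ x → φ (x ∙ x))

      lemma₁ : ∀ p d → p + p ≡ p + p + d - d
      lemma₁ = ℤ-solve-∀

      lemma₂ : ∀ κ t q t₂ →
        (+ 2 + κ) * ((+ 2 + κ) * t) + q - ((+ 2 + κ) * t + (+ 2 + κ) * t) - ((+ 2 + κ) * t + t₂ - (t + t))
        ≡ (+ 1 + κ) * κ * t + q - t₂
      lemma₂ = ℤ-solve-∀

      card-sym : ∀ u v → card a φ u v ≡ card a φ v u
      card-sym u v = cong₂ (λ x y → T + φ x - y) (comm (a u) (a v)) (ℤ.+-comm (φ (a u)) (φ (a v)))

      sum-card : ∀ {n} (s t t′ : Fin n → ℤ) → sum (λ v → T + s v - (t v + t′ v)) ≡ + n * T + sum s - (sum t + sum t′)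
      sum-card {n} s t t′ = trans (sum-- (λ v → T + s v) (λ v → t v + t′ v))
        (cong₂ _-_ (trans (∑-distrib-+ (λ _ → T) s) (cong (_+ sum s) (sum-const n T))) (∑-distrib-+ t t′))

      row : ∀ u → sum (card a φ u) ≡ N * T + sum (λ v → φ (a u ∙ a v)) - (N * φ (a u) + T)
      row u = trans (sum-card (λ v → φ (a u ∙ a v)) (λ _ → φ (a u)) (φ ∘ a))
        (cong (λ x → N * T + sum (λ v → φ (a u ∙ a v)) - (x + T)) (sum-const (2 ℕ.+ k) (φ (a u))))

      grid : sum (λ u → sum (card a φ u)) ≡ N * (N * T) + Q - (N * T + N * T)
      grid = trans (sum-cong-≗ row) (trans
        (sum-- (λ u → N * T + sum (λ v → φ (a u ∙ a v))) (λ u → N * φ (a u) + T))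
        (cong₂ _-_
          (trans (∑-distrib-+ {2 ℕ.+ k} (λ _ → N * T) (λ u → sum (λ v → φ (a u ∙ a v))))
                 (cong (_+ Q) (sum-const (2 ℕ.+ k) (N * T))))
          (trans (∑-distrib-+ (λ u → N * φ (a u)) (λ _ → T))
            (cong₂ _+_ (sym (*-distribˡ-sum N (φ ∘ a))) (sum-const (2 ℕ.+ k) T)))))

      diagonal : D ≡ N * T + T₂ - (T + T)
      diagonal = sum-card (λ u → φ (a u ∙ a u)) (φ ∘ a) (φ ∘ a)

    module _ (comm : Commutative _≡_ _∙_) {k} (a b : Fin (2 ℕ.+ k) → A)
             (same : ∀ φ → deckTotal a φ ≡ deckTotal b φ) where
      private
        Δ : (A → ℤ) → ℤ
        Δ φ = total a φ - total b φ

      -- The difference of the two `products` telescopes through the `mixed` sum over `a` and `b`.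
      -- Each half is then a sum of `Δ` over translates of `φ`, which makes the equation linear in
      -- `Δ`.
      Δ-equation : ∀ φ → + (suc k ℕ.* k) * Δ φ ≡
        Δ (λ x → φ (x ∙ x)) - (sum (λ v → Δ (λ x → φ (x ∙ a v))) + sum (λ v → Δ (λ x → φ (x ∙ b v))))
      Δ-equation φ = begin
        κ * (total a φ - total b φ)
          ≡⟨ lemma κ (total a φ) (total b φ) (products a φ) (products b φ) (total a φ₂) (total b φ₂) (same φ) ⟩
        Δ φ₂ - (products a φ - products b φ)
          ≡⟨ cong (λ z → Δ φ₂ - z) (sym (trans (cong₂ _+_ shiftᵃ shiftᵇ) (telescope (products a φ) _ (products b φ)))) ⟩
        Δ φ₂ - (sum (λ v → Δ (λ x → φ (x ∙ a v))) + sum (λ v → Δ (λ x → φ (x ∙ b v)))) ∎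
        where
        open ≡-Reasoning
        κ = + (suc k ℕ.* k)
        φ₂ : A → ℤ
        φ₂ x = φ (x ∙ x)

        lemma : ∀ κ t s q r t₂ s₂ → κ * t + q - t₂ ≡ κ * s + r - s₂ → κ * (t - s) ≡ t₂ - s₂ - (q - r)
        lemma κ t s q r t₂ s₂ eq = trans (left κ t s q t₂) (trans (cong (λ z → z - (κ * s + q - t₂)) eq) (right κ s q r t₂ s₂))
          where
          left : ∀ κ t s q t₂ → κ * (t - s) ≡ κ * t + q - t₂ - (κ * s + q - t₂)
          left = ℤ-solve-∀
          right : ∀ κ s q r t₂ s₂ → κ * s + r - s₂ - (κ * s + q - t₂) ≡ t₂ - s₂ - (q - r)
          right = ℤ-solve-∀

        telescope : ∀ x y z → x - y + (y - z) ≡ x - z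
        telescope = ℤ-solve-∀

        mixed : ℤ
        mixed = sum λ v → sum λ u → φ (b u ∙ a v)

        transposed : ∀ (d e : Fin (2 ℕ.+ k) → A) → sum (λ v → sum λ u → φ (d u ∙ e v)) ≡ sum (λ v → sum λ u → φ (e u ∙ d v))
        transposed d e = trans (∑-comm (λ v u → φ (d u ∙ e v)))
          (sum-cong-≗ λ v → sum-cong-≗ λ u → cong φ (comm (d v) (e u)))

        shiftᵃ : sum (λ v → Δ (λ x → φ (x ∙ a v))) ≡ products a φ - mixed
        shiftᵃ = trans (sum-- (λ v → total a (λ x → φ (x ∙ a v))) (λ v → total b (λ x → φ (x ∙ a v))))
          (cong (_- mixed) (∑-comm (λ v u → φ (a u ∙ a v))))

        shiftᵇ : sum (λ v → Δ (λ x → φ (x ∙ b v))) ≡ mixed - products b φ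
        shiftᵇ = trans (sum-- (λ v → total a (λ x → φ (x ∙ b v))) (λ v → total b (λ x → φ (x ∙ b v))))
          (cong₂ _-_ (transposed a b) (∑-comm (λ v u → φ (b u ∙ b v))))

      -- Were the absolute value at least K+1, the left side of `Δ-equation` would outweigh its
      -- right side, which has 2N+1 terms of size at most K+1. Those terms belong to doublings and
      -- translates of `p`, hence the bound for all predicates at once.
      ∣Δ∣≤suc⇒∣Δ∣≤ : 3 ℕ.≤ k → ∀ K → (∀ (p : A → Bool) → ∣ Δ (⟦_⟧ ∘ p) ∣ ℕ.≤ suc K) →
                     ∀ (p : A → Bool) → ∣ Δ (⟦_⟧ ∘ p) ∣ ℕ.≤ K
      ∣Δ∣≤suc⇒∣Δ∣≤ 3≤k K bound p with ∣ Δ (⟦_⟧ ∘ p) ∣ ℕ.≤? K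
      ... | yes ∣Δ∣≤K = ∣Δ∣≤K
      ... | no ∣Δ∣≰K = contradiction (begin-strict
        suc K ℕ.+ (N ℕ.* suc K ℕ.+ N ℕ.* suc K)   <⟨ few-shifts 3≤k ⟩
        suc k ℕ.* k ℕ.* suc K                     ≤⟨ ℕ.*-monoʳ-≤ (suc k ℕ.* k) (ℕ.≰⇒> ∣Δ∣≰K) ⟩
        suc k ℕ.* k ℕ.* ∣ Δ φ ∣                   ≡⟨ ℤ.abs-* (+ (suc k ℕ.* k)) (Δ φ) ⟨
        ∣ + (suc k ℕ.* k) * Δ φ ∣                 ≡⟨ cong ∣_∣ (Δ-equation φ) ⟩
        ∣ Δ (λ x → φ (x ∙ x)) - (Sᵃ + Sᵇ) ∣       ≤⟨ ℤ.∣i-j∣≤∣i∣+∣j∣ (Δ (λ x → φ (x ∙ x))) (Sᵃ + Sᵇ) ⟩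
        ∣ Δ (λ x → φ (x ∙ x)) ∣ ℕ.+ ∣ Sᵃ + Sᵇ ∣   ≤⟨ ℕ.+-mono-≤ (bound (λ x → p (x ∙ x)))
                                                     (ℕ.≤-trans (ℤ.∣i+j∣≤∣i∣+∣j∣ Sᵃ Sᵇ) (ℕ.+-mono-≤
                                                       (∣sum∣≤ (λ v → Δ (λ x → φ (x ∙ a v))) (suc K) λ v → bound (λ x → p (x ∙ a v)))
                                                       (∣sum∣≤ (λ v → Δ (λ x → φ (x ∙ b v))) (suc K) λ v → bound (λ x → p (x ∙ b v))))) ⟩
        suc K ℕ.+ (N ℕ.* suc K ℕ.+ N ℕ.* suc K)   ∎) (ℕ.<-irrefl refl)
        where
        open ℕ.≤-Reasoning
        N = 2 ℕ.+ k
        φ : A → ℤ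
        φ = ⟦_⟧ ∘ p
        Sᵃ = sum (λ v → Δ (λ x → φ (x ∙ a v)))
        Sᵇ = sum (λ v → Δ (λ x → φ (x ∙ b v)))

        -- For k = 3+m the factor (4+m)(3+m) exceeds 2(5+m)+1 by 1+m(5+m). For k = 2 it would be 6
        -- against 9, so arity four needs another argument.
        few-shifts : ∀ {k} → 3 ℕ.≤ k → suc K ℕ.+ ((2 ℕ.+ k) ℕ.* suc K ℕ.+ (2 ℕ.+ k) ℕ.* suc K) ℕ.< suc k ℕ.* k ℕ.* suc K
        few-shifts (ℕ.s≤s (ℕ.s≤s (ℕ.s≤s {n = m} ℕ.z≤n))) = ℕ.≤-trans (ℕ.m≤m+n _ _) (ℕ.≤-reflexive (identity m K))
          where
          identity : ∀ m K → suc (suc K ℕ.+ ((5 ℕ.+ m) ℕ.* suc K ℕ.+ (5 ℕ.+ m) ℕ.* suc K))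
                             ℕ.+ (K ℕ.+ m ℕ.* (5 ℕ.+ m) ℕ.* suc K)
                           ≡ (4 ℕ.+ m) ℕ.* (3 ℕ.+ m) ℕ.* suc K
          identity = ℕ-solve-∀

      -- Each of the two totals is at most N, and from the bound 2N the uniform bound descends to 0
      -- one step at a time.
      Δ-vanishes : 3 ℕ.≤ k → ∀ (p : A → Bool) → total a (⟦_⟧ ∘ p) ≡ total b (⟦_⟧ ∘ p)
      Δ-vanishes 3≤k p = ℤ.i-j≡0⇒i≡j _ _ (ℤ.∣i∣≡0⇒i≡0 (ℕ.n≤0⇒n≡0 (descend (N ℕ.* 1 ℕ.+ N ℕ.* 1) initial p)))
        where
        N = 2 ℕ.+ k

        ∣⟦_⟧∣≤1 : ∀ q → ∣ ⟦ q ⟧ ∣ ℕ.≤ 1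
        ∣⟦ true  ⟧∣≤1 = ℕ.≤-refl
        ∣⟦ false ⟧∣≤1 = ℕ.z≤n

        initial : ∀ (p : A → Bool) → ∣ Δ (⟦_⟧ ∘ p) ∣ ℕ.≤ N ℕ.* 1 ℕ.+ N ℕ.* 1
        initial p = ℕ.≤-trans (ℤ.∣i-j∣≤∣i∣+∣j∣ (total a (⟦_⟧ ∘ p)) (total b (⟦_⟧ ∘ p)))
          (ℕ.+-mono-≤ (∣sum∣≤ (⟦_⟧ ∘ p ∘ a) 1 (λ v → ∣⟦ p (a v) ⟧∣≤1)) (∣sum∣≤ (⟦_⟧ ∘ p ∘ b) 1 (λ v → ∣⟦ p (b v) ⟧∣≤1)))

        descend : ∀ K → (∀ (p : A → Bool) → ∣ Δ (⟦_⟧ ∘ p) ∣ ℕ.≤ K) → ∀ (p : A → Bool) → ∣ Δ (⟦_⟧ ∘ p) ∣ ℕ.≤ 0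
        descend zero    bound = bound
        descend (suc K) bound = descend K (∣Δ∣≤suc⇒∣Δ∣≤ 3≤k K bound)

-- Multisets of size four over ℤ/2 and ℤ/3

module _ {m : ℕ} where
  addMod : Op₂ (Fin (suc m))
  addMod u v = (toℕ u ℕ.+ toℕ v) mod suc m

  open Cards addMod using (deckTotal)

  -- Only indicators of single elements are tested, which keeps the condition decidable.
  SameCards SameOccurrences : (a b : Fin 4 → Fin (suc m)) → Set
  SameCards a b = ∀ x → deckTotal a (λ y → ⟦ does (y ≟ x) ⟧) ≡ deckTotal b (λ y → ⟦ does (y ≟ x) ⟧)
  SameOccurrences a b = ∀ x → occurrences _≟_ x a ≡ occurrences _≟_ x b

  -- The condition on sums matters: over ℤ/2 the multisets 1,1,1,0 and 1,1,1,1 satisfy `SameCards`,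
  -- and only their sums 1 and 0 tell them apart.
  Reconstructible : (a b : Fin 4 → Fin (suc m)) → Set
  Reconstructible a b = foldr addMod zero a ≡ foldr addMod zero b → SameCards a b → SameOccurrences a b

  reconstructible? : ∀ a b → Dec (Reconstructible a b)
  reconstructible? a b = (foldr addMod zero a ≟ foldr addMod zero b) →-dec
    ((all? λ x → deckTotal a (λ y → ⟦ does (y ≟ x) ⟧) ℤ.≟ deckTotal b (λ y → ⟦ does (y ≟ x) ⟧)) →-dec
     (all? λ x → occurrences _≟_ x a ℤ.≟ occurrences _≟_ x b))

four : ∀ {m} (u v w x : Fin m) → Fin 4 → Fin m
four u v w x = lookup (u ∷ v ∷ w ∷ x ∷ [])

-- The decision procedure is evaluated on all values. `Reconstructible` unfolds to an expression in
-- the eight values of `a` and `b`, so the result for `four` is the result for `a` and `b` by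
-- computation.
reconstruct-mod-2 : (a b : Fin 4 → Fin 2) → Reconstructible a b
reconstruct-mod-2 a b = from-yes
  (all? λ a₀ → all? λ a₁ → all? λ a₂ → all? λ a₃ →
   all? λ b₀ → all? λ b₁ → all? λ b₂ → all? λ b₃ →
   reconstructible? (four {2} a₀ a₁ a₂ a₃) (four b₀ b₁ b₂ b₃))
  (a 0F) (a 1F) (a 2F) (a 3F) (b 0F) (b 1F) (b 2F) (b 3F)

reconstruct-mod-3 : (a b : Fin 4 → Fin 3) → Reconstructible a b
reconstruct-mod-3 a b = from-yes
  (all? λ a₀ → all? λ a₁ → all? λ a₂ → all? λ a₃ →
   all? λ b₀ → all? λ b₁ → all? λ b₂ → all? λ b₃ →
   reconstructible? (four {3} a₀ a₁ a₂ a₃) (four b₀ b₁ b₂ b₃))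
  (a 0F) (a 1F) (a 2F) (a 3F) (b 0F) (b 1F) (b 2F) (b 3F)

-- Minors

-- The map of indices behind a minor: by `minor-tabulate`, forming the minor means precomposing
-- arguments with it. It is a left inverse of `punchIn j`.
retraction : ∀ {n} → Pair (suc n) → Fin (suc n) → Fin n
retraction (j , i) = insertAt id j (inject! i)

retraction-larger : ∀ {n} (I : Pair (suc n)) → retraction I (larger I) ≡ inject! (proj₂ I)
retraction-larger (j , i) = insertAt-lookup id j (inject! i)

retraction-punchIn : ∀ {n} (I : Pair (suc n)) k → retraction I (punchIn (larger I) k) ≡ k
retraction-punchIn (j , i) = insertAt-punchIn id j (inject! i)

module _ {a} {A : Set a} where
  open ≡-Reasoning

  ≗-punchIn : ∀ {n} (x y : Fin (suc n) → A) j → x j ≡ y j → x ∘ punchIn j ≗ y ∘ punchIn j → x ≗ y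
  ≗-punchIn x y j at-j off-j k with j ≟ k
  ... | yes refl = at-j
  ... | no j≢k   = subst (λ l → x l ≡ y l) (punchIn-punchOut j≢k) (off-j (punchOut j≢k))

  minor-tabulate : ∀ {n b} {B : Set b} (f : Fun A B (suc n)) (I : Pair (suc n)) y →
                   minor f I (tabulate y) ≡ f (tabulate (y ∘ retraction I))
  minor-tabulate f I@(j , i) y = cong f (trans (sym (tabulate∘lookup xs)) (tabulate-cong
    (≗-punchIn (lookup xs) (y ∘ retraction I) j
    (begin
      lookup xs j              ≡⟨ Vec.insertAt-lookup (tabulate y) j _ ⟩
      lookup (tabulate y) (inject! i) ≡⟨ lookup∘tabulate y (inject! i) ⟩
      y (inject! i)            ≡⟨ cong y (retraction-larger I) ⟨
      y (retraction I j)       ∎)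
    (λ k → begin
      lookup xs (punchIn j k)  ≡⟨ Vec.insertAt-punchIn (tabulate y) j _ k ⟩
      lookup (tabulate y) k    ≡⟨ lookup∘tabulate y k ⟩
      y k                      ≡⟨ cong y (retraction-punchIn I k) ⟨
      y (retraction I (punchIn j k)) ∎))))
    where xs = Vec.insertAt (tabulate y) j (lookup (tabulate y) (inject! i))

  -- On the diagonal, deleting the larger entry loses no information, since the retraction restores
  -- it from the smaller one.
  factor-retraction : ∀ {n} (I : Pair (suc n)) (x : Fin (suc n) → A) → x (smaller I) ≡ x (larger I) →
                      x ≗ x ∘ punchIn (larger I) ∘ retraction I
  factor-retraction I x eq = ≗-punchIn x (x ∘ punchIn (larger I) ∘ retraction I) (larger I)
    (trans (sym eq) (cong (x ∘ punchIn (larger I)) (sym (retraction-larger I))))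
    (λ k → cong (x ∘ punchIn (larger I)) (sym (retraction-punchIn I k)))

joining : ∀ {n} (p q : Fin (suc n)) → p ≢ q →
          ∃ λ I → (smaller I ≡ p × larger I ≡ q) ⊎ (smaller I ≡ q × larger I ≡ p)
joining         zero    zero    p≢q = contradiction refl p≢q
joining {suc n} zero    (suc q) p≢q = (suc q , zero) , inj₁ (refl , refl)
joining {suc n} (suc p) zero    p≢q = (suc p , zero) , inj₂ (refl , refl)
joining {suc n} (suc p) (suc q) p≢q with joining p q (p≢q ∘ cong suc)
... | (j , i) , inj₁ (s≡p , l≡q) = (suc j , suc i) , inj₁ (cong suc s≡p , cong suc l≡q)
... | (j , i) , inj₂ (s≡q , l≡p) = (suc j , suc i) , inj₂ (cong suc s≡q , cong suc l≡p)

-- Minors of affine functions over a finite field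

module _ {c} {q : ℕ} (F : FiniteField c q) where
  open ≡-Reasoning
  open FiniteField F using (Carrier; isHeytingField; enumeration)

  commutativeRing : CommutativeRing c c
  commutativeRing = record { isCommutativeRing = IsHeytingField.isCommutativeRing isHeytingField }

  open CommutativeRing commutativeRing
    using ( 0#; 1#; _+_; _*_; -_; ring; semiring; +-comm; +-identityˡ; +-identityʳ
          ; *-identityˡ; *-identityʳ; zeroʳ; -‿inverseˡ; -‿inverseʳ )
  open Linear commutativeRing
  open import Algebra.Properties.Semiring.Sum semiring using (sum; sum-cong-≗; sum-remove; sum-permute)
  open RingProperties ring using (-‿involutive; -‿+-comm; +-cancelˡ; +-cancelʳ; -0#≈0#)
  open Cards _+_

  _≟ᶠ_ : DecidableEquality Carrier
  _≟ᶠ_ = via-injection (↔⇒↣ enumeration) _≟_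

  repetition : ∀ {n} → q ℕ.< n → (x : Fin n → Carrier) → ∃₂ λ i j → i ≢ j × x i ≡ x j
  repetition q<n x with i , j , i<j , eq ← pigeonhole q<n (Inverse.to enumeration ∘ x) =
    i , j , Fin.<⇒≢ i<j , Injection.injective (↔⇒↣ enumeration) eq

  foldr-zipWith : ∀ {n} (as xs : Vec Carrier n) → foldr′ _+_ 0# (zipWith _*_ as xs) ≡ lookup as ∙ lookup xs
  foldr-zipWith []       []       = refl
  foldr-zipWith (a ∷ as) (x ∷ xs) = cong (a * x +_) (foldr-zipWith as xs)

  -- By `∙-pushforward`, these are the coefficients of the minor at `I` of an affine function with
  -- coefficients `a`.
  merged : ∀ {n} → Pair (suc n) → (Fin (suc n) → Carrier) → Fin n → Carrier
  merged I = pushforward (retraction I)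

  merged≡ : ∀ {n} (I : Pair (suc n)) a k → merged I a k ≡ a (larger I) * δ k (inject! (proj₂ I)) + a (punchIn (larger I) k)
  merged≡ {n} I a k = begin
    merged I a k
      ≡⟨ sum-remove {i = larger I} (λ l → a l * δ k (retraction I l)) ⟩
    a (larger I) * δ k (retraction I (larger I)) + sum (λ l → a (punchIn (larger I) l) * δ k (retraction I (punchIn (larger I) l)))
      ≡⟨ cong₂ _+_ (cong (λ l → a (larger I) * δ k l) (retraction-larger I))
          (sum-cong-≗ {n} λ l → cong (λ m → a (punchIn (larger I) l) * δ k m) (retraction-punchIn I l)) ⟩
    a (larger I) * δ k (inject! (proj₂ I)) + (a ∘ punchIn (larger I)) ∙ δ k
      ≡⟨ cong (a (larger I) * δ k (inject! (proj₂ I)) +_) (∙-δ (a ∘ punchIn (larger I)) k) ⟩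
    a (larger I) * δ k (inject! (proj₂ I)) + a (punchIn (larger I) k) ∎

  -- In the minor the sum of the two merged coefficients stands at `inject! i`, and the other
  -- coefficients are those of `a` off the pair. So the coefficients of minors are the cards of the
  -- multiset of coefficients.
  total-merged : ∀ {n} (I : Pair (2 ℕ.+ n)) a φ → total (merged I a) φ ≡ card a φ (smaller I) (larger I)
  total-merged {n} I@(j , i) a φ = begin
    total (merged I a) φ
      ≡⟨ ℤΣ.sum-remove {i = inject! i} (φ ∘ merged I a) ⟩
    φ (merged I a (inject! i)) ℤ.+ ℤΣ.sum (λ l → φ (merged I a (punchIn (inject! i) l)))
      ≡⟨ cong₂ ℤ._+_ (cong φ at-i) (ℤΣ.sum-cong-≗ {n} λ l → cong φ (off-i l)) ⟩
    φ (a (smaller I) + a j) ℤ.+ rest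
      ≡⟨ lemma (φ (a (smaller I) + a j)) rest (φ (a (smaller I))) (φ (a j)) ⟩
    φ (a j) ℤ.+ (φ (a (smaller I)) ℤ.+ rest) ℤ.+ φ (a (smaller I) + a j) ℤ.- (φ (a (smaller I)) ℤ.+ φ (a j))
      ≡⟨ cong (λ t → t ℤ.+ φ (a (smaller I) + a j) ℤ.- (φ (a (smaller I)) ℤ.+ φ (a j)))
           (trans (ℤΣ.sum-remove {i = j} (φ ∘ a))
                  (cong (λ t → φ (a j) ℤ.+ t) (ℤΣ.sum-remove {i = inject! i} (φ ∘ a ∘ punchIn j)))) ⟨
    card a φ (smaller I) (larger I) ∎
    where
    rest : ℤ.ℤ
    rest = ℤΣ.sum (λ l → φ (a (punchIn j (punchIn (inject! i) l))))

    lemma : ∀ x r s t → x ℤ.+ r ≡ t ℤ.+ (s ℤ.+ r) ℤ.+ x ℤ.- (s ℤ.+ t)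
    lemma = ℤ-solve-∀

    at-i : merged I a (inject! i) ≡ a (smaller I) + a j
    at-i = trans (merged≡ I a (inject! i)) (trans
      (cong (_+ a (smaller I)) (trans (cong (a j *_) (δ-refl (inject! i))) (*-identityʳ (a j))))
      (+-comm (a j) (a (smaller I))))

    off-i : ∀ l → merged I a (punchIn (inject! i) l) ≡ a (punchIn j (punchIn (inject! i) l))
    off-i l = trans (merged≡ I a _) (trans
      (cong (_+ a (punchIn j (punchIn (inject! i) l)))
        (trans (cong (a j *_) (δ-≢ (punchInᵢ≢i (inject! i) l))) (zeroʳ (a j))))
      (+-identityˡ _))

  δ-permute : ∀ {n} (σ : Permutation′ n) k l → δ (σ ⟨$⟩ʳ k) (σ ⟨$⟩ʳ l) ≡ δ k l
  δ-permute σ k l with k ≟ l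
  ... | yes refl = δ-refl (σ ⟨$⟩ʳ k)
  ... | no k≢l   = δ-≢ (k≢l ∘ Injection.injective (↔⇒↣ σ))

  module _ {n} (f g : Fun Carrier Carrier (3 ℕ.+ n)) (g≈f : g ≈deck f)
           (a : Fin (3 ℕ.+ n) → Carrier) (k : Carrier) (f≗ : ∀ x → f (tabulate x) ≡ a ∙ x + k) where
    private
      π = proj₁ g≈f
      σ : Pair (3 ℕ.+ n) → Permutation′ (2 ℕ.+ n)
      σ I = proj₁ (proj₂ g≈f I)

    g-on-diagonal : ∀ I (y : Fin (2 ℕ.+ n) → Carrier) →
      g (tabulate (y ∘ retraction I)) ≡ a ∙ (λ l → y (σ I ⟨$⟩ʳ retraction (Inverse.to π I) l)) + k
    g-on-diagonal I y = begin
      g (tabulate (y ∘ retraction I))             ≡⟨ minor-tabulate g I y ⟨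
      minor g I (tabulate y)                      ≡⟨ proj₂ (proj₂ g≈f I) (tabulate y) ⟩
      minor f (Inverse.to π I) (tabulate λ l → lookup (tabulate y) (σ I ⟨$⟩ʳ l))
        ≡⟨ cong (minor f (Inverse.to π I)) (tabulate-cong λ l → lookup∘tabulate y (σ I ⟨$⟩ʳ l)) ⟩
      minor f (Inverse.to π I) (tabulate (λ l → y (σ I ⟨$⟩ʳ l)))
        ≡⟨ minor-tabulate f (Inverse.to π I) (λ l → y (σ I ⟨$⟩ʳ l)) ⟩
      f (tabulate (λ l → y (σ I ⟨$⟩ʳ retraction (Inverse.to π I) l)))
        ≡⟨ f≗ (λ l → y (σ I ⟨$⟩ʳ retraction (Inverse.to π I) l)) ⟩
      a ∙ (λ l → y (σ I ⟨$⟩ʳ retraction (Inverse.to π I) l)) + k ∎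

    g-affine-on-diagonals : ∀ {p r} → p ≢ r → ∃₂ λ b d → ∀ x → x p ≡ x r → g (tabulate x) ≡ b ∙ x + d
    g-affine-on-diagonals {p} {r} p≢r with I , joins ← joining p r p≢r =
      pushforward ρ a , k , λ x eq → begin
        g (tabulate x)
          ≡⟨ cong g (tabulate-cong (factor-retraction I x (on-diagonal joins x eq))) ⟩
        g (tabulate (x ∘ punchIn (larger I) ∘ retraction I)) ≡⟨ g-on-diagonal I (x ∘ punchIn (larger I)) ⟩
        a ∙ (x ∘ ρ) + k              ≡⟨ cong (_+ k) (∙-pushforward ρ a x) ⟩
        pushforward ρ a ∙ x + k      ∎
      where
      -- `ρ` takes a variable of `f` to the variable of `g` substituted for it: merge along the
      -- matched pair, permute, then skip the larger index of `I`.
      ρ : Fin (3 ℕ.+ n) → Fin (3 ℕ.+ n)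
      ρ l = punchIn (larger I) (σ I ⟨$⟩ʳ retraction (Inverse.to π I) l)

      on-diagonal : (smaller I ≡ p × larger I ≡ r) ⊎ (smaller I ≡ r × larger I ≡ p) →
                    ∀ (x : Fin (3 ℕ.+ n) → Carrier) → x p ≡ x r → x (smaller I) ≡ x (larger I)
      on-diagonal (inj₁ (refl , refl)) x eq = eq
      on-diagonal (inj₂ (refl , refl)) x eq = sym eq

    module _ (b : Fin (3 ℕ.+ n) → Carrier) (d : Carrier) (g≗ : ∀ x → g (tabulate x) ≡ b ∙ x + d) where

      minors-agree : ∀ I (y : Fin (2 ℕ.+ n) → Carrier) →
        merged I b ∙ y + d ≡ merged (Inverse.to π I) a ∙ (λ l → y (σ I ⟨$⟩ʳ l)) + k
      minors-agree I y = begin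
        merged I b ∙ y + d               ≡⟨ cong (_+ d) (∙-pushforward (retraction I) b y) ⟨
        b ∙ (y ∘ retraction I) + d       ≡⟨ g≗ (y ∘ retraction I) ⟨
        g (tabulate (y ∘ retraction I))  ≡⟨ g-on-diagonal I y ⟩
        a ∙ ((λ l → y (σ I ⟨$⟩ʳ l)) ∘ retraction (Inverse.to π I)) + k
          ≡⟨ cong (_+ k) (∙-pushforward (retraction (Inverse.to π I)) a (λ l → y (σ I ⟨$⟩ʳ l))) ⟩
        merged (Inverse.to π I) a ∙ (λ l → y (σ I ⟨$⟩ʳ l)) + k ∎

      same-constant : d ≡ k
      same-constant = begin
        d                             ≡⟨ +-identityˡ d ⟨
        0# + d                        ≡⟨ cong (_+ d) (∙-0 (merged I b)) ⟨
        merged I b ∙ (λ _ → 0#) + d   ≡⟨ minors-agree I (λ _ → 0#) ⟩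
        merged (Inverse.to π I) a ∙ (λ _ → 0#) + k  ≡⟨ cong (_+ k) (∙-0 (merged (Inverse.to π I) a)) ⟩
        0# + k                        ≡⟨ +-identityˡ k ⟩
        k                             ∎
        where
        I : Pair (3 ℕ.+ n)
        I = suc zero , zero

      -- Both affine expressions for the minor are evaluated at a unit vector, and the constants
      -- cancel.
      merged-agree : ∀ I l → merged I b (σ I ⟨$⟩ʳ l) ≡ merged (Inverse.to π I) a l
      merged-agree I l = +-cancelʳ d _ _ (begin
        merged I b (σ I ⟨$⟩ʳ l) + d               ≡⟨ cong (_+ d) (∙-δ (merged I b) (σ I ⟨$⟩ʳ l)) ⟨
        merged I b ∙ δ (σ I ⟨$⟩ʳ l) + d           ≡⟨ minors-agree I (δ (σ I ⟨$⟩ʳ l)) ⟩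
        merged J a ∙ (λ m → δ (σ I ⟨$⟩ʳ l) (σ I ⟨$⟩ʳ m)) + k
          ≡⟨ cong₂ _+_ (∙-congʳ′ (merged J a) (δ-permute (σ I) l)) (sym same-constant) ⟩
        merged J a ∙ δ l + d                      ≡⟨ cong (_+ d) (∙-δ (merged J a) l) ⟩
        merged J a l + d                          ∎)
        where J = Inverse.to π I

      -- Matched minors have the same coefficients up to order, hence equal sums of `φ`; the
      -- bijection `π` only reorders the sum over pairs.
      same-deckTotal : ∀ φ → deckTotal a φ ≡ deckTotal b φ
      same-deckTotal φ = begin
        deckTotal a φ                             ≡⟨ sumPairs-card +-comm a φ ⟨
        P a ℤ.+ P a                               ≡⟨ cong (λ p → p ℤ.+ p) (begin
          P a                                     ≡⟨ sumPairs-permute (λ I → card a φ (smaller I) (larger I)) π ⟩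
          sumPairs (λ I → card a φ (smaller (Inverse.to π I)) (larger (Inverse.to π I))) ≡⟨ sumPairs-cong (λ I → begin
            card a φ (smaller (Inverse.to π I)) (larger (Inverse.to π I)) ≡⟨ total-merged (Inverse.to π I) a φ ⟨
            total (merged (Inverse.to π I) a) φ   ≡⟨ ℤΣ.sum-cong-≗ {2 ℕ.+ n} (λ l → cong φ (merged-agree I l)) ⟨
            total (λ l → merged I b (σ I ⟨$⟩ʳ l)) φ ≡⟨ ℤΣ.sum-permute (φ ∘ merged I b) (σ I) ⟨
            total (merged I b) φ                  ≡⟨ total-merged I b φ ⟩
            card b φ (smaller I) (larger I)       ∎) ⟩
          P b                                     ∎) ⟩
        P b ℤ.+ P b                               ≡⟨ sumPairs-card +-comm b φ ⟩
        deckTotal b φ                             ∎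
        where
        P : (Fin (3 ℕ.+ n) → Carrier) → ℤ.ℤ
        P e = sumPairs (λ I → card e φ (smaller I) (larger I))

      -- The all-ones vector lies on every diagonal, so `g` and `f` take the same value there. This
      -- settles the ambiguous multisets in arity four.
      same-sum : sum a ≡ sum b
      same-sum = +-cancelʳ d _ _ (begin
        sum a + d                    ≡⟨ cong (_+ d) (ones a) ⟨
        a ∙ (λ _ → 1#) + d           ≡⟨ cong (a ∙ (λ _ → 1#) +_) same-constant ⟩
        a ∙ (λ _ → 1#) + k           ≡⟨ g-on-diagonal (suc zero , zero) (λ _ → 1#) ⟨
        g (tabulate {n = 3 ℕ.+ n} (λ _ → 1#)) ≡⟨ g≗ (λ _ → 1#) ⟩
        b ∙ (λ _ → 1#) + d           ≡⟨ cong (_+ d) (ones b) ⟩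
        sum b + d                    ∎)
        where
        ones : ∀ (e : Fin (3 ℕ.+ n) → Carrier) → e ∙ (λ _ → 1#) ≡ sum e
        ones e = sum-cong-≗ {3 ℕ.+ n} (λ l → *-identityʳ (e l))

      permuted⇒≋ : (∃ λ (τ : Permutation′ (3 ℕ.+ n)) → ∀ l → a l ≡ b (τ ⟨$⟩ʳ l)) → g ≋ f
      permuted⇒≋ (τ , a≗b∘τ) = τ , λ xs → begin
        g xs                                   ≡⟨ cong g (tabulate∘lookup xs) ⟨
        g (tabulate (lookup xs))               ≡⟨ g≗ (lookup xs) ⟩
        b ∙ lookup xs + d                      ≡⟨ cong₂ _+_ (sum-permute (λ l → b l * lookup xs l) τ) same-constant ⟩
        (λ l → b (τ ⟨$⟩ʳ l)) ∙ (λ l → lookup xs (τ ⟨$⟩ʳ l)) + k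
          ≡⟨ cong (_+ k) (∙-congˡ′ (λ l → lookup xs (τ ⟨$⟩ʳ l)) a≗b∘τ) ⟨
        a ∙ (λ l → lookup xs (τ ⟨$⟩ʳ l)) + k   ≡⟨ f≗ (λ l → lookup xs (τ ⟨$⟩ʳ l)) ⟨
        f (tabulate λ l → lookup xs (τ ⟨$⟩ʳ l)) ∎

  -- Four coefficients

  module _ {m} (ι : Fin (suc m) → Carrier) (ι-injective : Injective _≡_ _≡_ ι)
           (ι-0 : ι zero ≡ 0#) (ι-+ : ∀ u v → ι (addMod u v) ≡ ι u + ι v) (ι-surjective : ∀ x → ∃ λ u → ι u ≡ x) where
    private
      code : Carrier → Fin (suc m)
      code x = proj₁ (ι-surjective x)

      ι-code : ∀ x → ι (code x) ≡ x
      ι-code x = proj₂ (ι-surjective x)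

      code-0 : code 0# ≡ zero
      code-0 = ι-injective (trans (ι-code 0#) (sym ι-0))

      code-+ : ∀ x y → code (x + y) ≡ addMod (code x) (code y)
      code-+ x y = ι-injective (begin
        ι (code (x + y))              ≡⟨ ι-code (x + y) ⟩
        x + y                         ≡⟨ cong₂ _+_ (ι-code x) (ι-code y) ⟨
        ι (code x) + ι (code y)       ≡⟨ ι-+ (code x) (code y) ⟨
        ι (addMod (code x) (code y))  ∎)

      code-sum : ∀ {n} (a : Fin n → Carrier) → code (sum a) ≡ foldr addMod zero (code ∘ a)
      code-sum {zero}  a = code-0
      code-sum {suc n} a = trans (code-+ (a zero) (sum (a ∘ suc))) (cong (addMod (code (a zero))) (code-sum (a ∘ suc)))

      code-deckTotal : ∀ {n} (a : Fin (2 ℕ.+ n) → Carrier) φ → Cards.deckTotal addMod (code ∘ a) φ ≡ deckTotal a (φ ∘ code)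
      code-deckTotal {n} a φ = cong₂ (λ s t → ℤ.+ (suc n ℕ.* n) ℤ.* total a (φ ∘ code) ℤ.+ s ℤ.- t)
        (ℤΣ.sum-cong-≗ {2 ℕ.+ n} λ u → ℤΣ.sum-cong-≗ {2 ℕ.+ n} λ v → cong φ (sym (code-+ (a u) (a v))))
        (ℤΣ.sum-cong-≗ {2 ℕ.+ n} λ u → cong φ (sym (code-+ (a u) (a u))))

    -- Both hypotheses involve only addition, so they carry over along `code`, the inverse of the
    -- additive isomorphism `ι`, to residues, where the exhaustive check applies.
    reconstruct-via : (∀ a b → Reconstructible {m} a b) → ∀ (a b : Fin 4 → Carrier) → sum a ≡ sum b →
                      (∀ φ → deckTotal a φ ≡ deckTotal b φ) → ∃ λ (τ : Permutation′ 4) → ∀ l → a l ≡ b (τ ⟨$⟩ʳ l)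
    reconstruct-via reconstruct a b same-sum same-deckTotal =
      let τ , codes = codes-permuted in
      τ , λ l → trans (sym (ι-code (a l))) (trans (cong ι (codes l)) (ι-code (b (τ ⟨$⟩ʳ l))))
      where
      same-code-sum : foldr addMod zero (code ∘ a) ≡ foldr addMod zero (code ∘ b)
      same-code-sum = trans (sym (code-sum a)) (trans (cong code same-sum) (code-sum b))

      same-cards : SameCards (code ∘ a) (code ∘ b)
      same-cards x = trans (code-deckTotal a φ) (trans (same-deckTotal (φ ∘ code)) (sym (code-deckTotal b φ)))
        where
        φ : Fin (suc m) → ℤ.ℤ
        φ y = ⟦ does (y ≟ x) ⟧

      same-occurrences : SameOccurrences (code ∘ a) (code ∘ b)
      same-occurrences = reconstruct (code ∘ a) (code ∘ b) same-code-sum same-cards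

      codes-permuted : ∃ λ (τ : Permutation′ 4) → ∀ l → code (a l) ≡ code (b (τ ⟨$⟩ʳ l))
      codes-permuted = occurrences⇒permutation _≟_ {n = 4} (code ∘ a) (code ∘ b) same-occurrences

  -- In a Heyting field elements with invertible difference are apart, and `1#` inverts the
  -- difference `1# + - 0#`.
  1≢0 : 1# ≢ 0#
  1≢0 = IsHeytingField.invertible⇒# isHeytingField (1# , trans (*-identityˡ _) 1-0≡1 , trans (*-identityʳ _) 1-0≡1)
    where
    1-0≡1 : 1# + - 0# ≡ 1#
    1-0≡1 = trans (cong (1# +_) -0#≈0#) (+-identityʳ 1#)

  module _ (q<4 : q ℕ.< 4) where

    no-four-distinct : ∀ {w x y z} → w ≢ x → w ≢ y → w ≢ z → x ≢ y → x ≢ z → ¬ y ≢ z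
    no-four-distinct {w} {x} {y} {z} w≢x w≢y w≢z x≢y x≢z y≢z =
      let i , j , i≢j , eq = repetition q<4 (lookup (w ∷ x ∷ y ∷ z ∷ [])) in i≢j (injective i j eq)
      where
      injective : ∀ i j → lookup (w ∷ x ∷ y ∷ z ∷ []) i ≡ lookup (w ∷ x ∷ y ∷ z ∷ []) j → i ≡ j
      injective 0F 0F _  = refl
      injective 0F 1F eq = contradiction eq w≢x
      injective 0F 2F eq = contradiction eq w≢y
      injective 0F 3F eq = contradiction eq w≢z
      injective 1F 0F eq = contradiction (sym eq) w≢x
      injective 1F 1F _  = refl
      injective 1F 2F eq = contradiction eq x≢y
      injective 1F 3F eq = contradiction eq x≢z
      injective 2F 0F eq = contradiction (sym eq) w≢y
      injective 2F 1F eq = contradiction (sym eq) x≢y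
      injective 2F 2F _  = refl
      injective 2F 3F eq = contradiction eq y≢z
      injective 3F 0F eq = contradiction (sym eq) w≢z
      injective 3F 1F eq = contradiction (sym eq) x≢z
      injective 3F 2F eq = contradiction (sym eq) y≢z
      injective 3F 3F _  = refl

    reconstruct-char-2 : 1# + 1# ≡ 0# → ∀ (a b : Fin 4 → Carrier) → sum a ≡ sum b →
                         (∀ φ → deckTotal a φ ≡ deckTotal b φ) → ∃ λ (τ : Permutation′ 4) → ∀ l → a l ≡ b (τ ⟨$⟩ʳ l)
    reconstruct-char-2 1+1≡0 = reconstruct-via ι ι-injective refl ι-+ ι-surjective reconstruct-mod-2
      where
      ι : Fin 2 → Carrier
      ι 0F = 0#
      ι 1F = 1#

      ι-injective : Injective _≡_ _≡_ ι
      ι-injective {0F} {0F} eq = refl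
      ι-injective {0F} {1F} eq = contradiction (sym eq) 1≢0
      ι-injective {1F} {0F} eq = contradiction eq 1≢0
      ι-injective {1F} {1F} eq = refl

      ι-+ : ∀ u v → ι (addMod u v) ≡ ι u + ι v
      ι-+ 0F 0F = sym (+-identityˡ 0#)
      ι-+ 0F 1F = sym (+-identityˡ 1#)
      ι-+ 1F 0F = sym (+-identityʳ 1#)
      ι-+ 1F 1F = sym 1+1≡0

      -- Otherwise 0, 1, x, x + 1 are four distinct elements.
      ι-surjective : ∀ x → ∃ λ u → ι u ≡ x
      ι-surjective x with 0# ≟ᶠ x | 1# ≟ᶠ x
      ... | yes 0≡x | _       = 0F , 0≡x
      ... | no _    | yes 1≡x = 1F , 1≡x
      ... | no 0≢x  | no 1≢x  = contradiction x≢x+1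
        (no-four-distinct (1≢0 ∘ sym) 0≢x 0≢x+1 1≢x 1≢x+1)
        where
        0≢x+1 : 0# ≢ x + 1#
        0≢x+1 eq = 1≢x (+-cancelʳ 1# _ _ (trans 1+1≡0 eq))

        1≢x+1 : 1# ≢ x + 1#
        1≢x+1 eq = 0≢x (+-cancelʳ 1# _ _ (trans (+-identityˡ 1#) eq))

        x≢x+1 : x ≢ x + 1#
        x≢x+1 eq = 1≢0 (sym (+-cancelˡ x _ _ (trans (+-identityʳ x) eq)))

    -- Here 0, 1 and -1 are distinct, and with fewer than four elements they are the whole field, so
    -- its additive group is ℤ/3.
    reconstruct-char-3 : 1# + 1# ≢ 0# → ∀ (a b : Fin 4 → Carrier) → sum a ≡ sum b →
                         (∀ φ → deckTotal a φ ≡ deckTotal b φ) → ∃ λ (τ : Permutation′ 4) → ∀ l → a l ≡ b (τ ⟨$⟩ʳ l)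
    reconstruct-char-3 1+1≢0 = reconstruct-via ι ι-injective refl ι-+ ι-surjective reconstruct-mod-3
      where
      ι : Fin 3 → Carrier
      ι 0F = 0#
      ι 1F = 1#
      ι 2F = - 1#

      0≢-1 : 0# ≢ - 1#
      0≢-1 0≡-1 = 1≢0 (trans (sym (-‿involutive 1#)) (trans (cong -_ (sym 0≡-1)) -0#≈0#))

      1≢-1 : 1# ≢ - 1#
      1≢-1 1≡-1 = 1+1≢0 (trans (cong (1# +_) 1≡-1) (-‿inverseʳ 1#))

      ι-injective : Injective _≡_ _≡_ ι
      ι-injective {0F} {0F} eq = refl
      ι-injective {0F} {1F} eq = contradiction (sym eq) 1≢0
      ι-injective {0F} {2F} eq = contradiction eq 0≢-1
      ι-injective {1F} {0F} eq = contradiction eq 1≢0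
      ι-injective {1F} {1F} eq = refl
      ι-injective {1F} {2F} eq = contradiction eq 1≢-1
      ι-injective {2F} {0F} eq = contradiction (sym eq) 0≢-1
      ι-injective {2F} {1F} eq = contradiction (sym eq) 1≢-1
      ι-injective {2F} {2F} eq = refl

      ι-surjective : ∀ x → ∃ λ u → ι u ≡ x
      ι-surjective x with 0# ≟ᶠ x | 1# ≟ᶠ x | (- 1#) ≟ᶠ x
      ... | yes 0≡x | _       | _        = 0F , 0≡x
      ... | no _    | yes 1≡x | _        = 1F , 1≡x
      ... | no _    | no _    | yes -1≡x = 2F , -1≡x
      ... | no 0≢x  | no 1≢x  | no -1≢x  = contradiction -1≢x
        (no-four-distinct (1≢0 ∘ sym) 0≢-1 0≢x 1≢-1 1≢x)

      -- By exclusion: the value 0 is ruled out by hypothesis, and the value 1 would give 1 = 0.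
      1+1≡-1 : 1# + 1# ≡ - 1#
      1+1≡-1 with ι-surjective (1# + 1#)
      ... | 0F , 0≡1+1  = contradiction (sym 0≡1+1) 1+1≢0
      ... | 1F , 1≡1+1  = contradiction (+-cancelˡ 1# _ _ (trans (sym 1≡1+1) (sym (+-identityʳ 1#)))) 1≢0
      ... | 2F , -1≡1+1 = sym -1≡1+1

      ι-+ : ∀ u v → ι (addMod u v) ≡ ι u + ι v
      ι-+ 0F 0F = sym (+-identityˡ 0#)
      ι-+ 0F 1F = sym (+-identityˡ 1#)
      ι-+ 0F 2F = sym (+-identityˡ (- 1#))
      ι-+ 1F 0F = sym (+-identityʳ 1#)
      ι-+ 1F 1F = sym 1+1≡-1
      ι-+ 1F 2F = sym (-‿inverseʳ 1#)
      ι-+ 2F 0F = sym (+-identityʳ (- 1#))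
      ι-+ 2F 1F = sym (-‿inverseˡ 1#)
      ι-+ 2F 2F = begin
        1#                  ≡⟨ -‿involutive 1# ⟨
        - (- 1#)            ≡⟨ cong -_ 1+1≡-1 ⟨
        - (1# + 1#)         ≡⟨ -‿+-comm 1# 1# ⟨
        - 1# + - 1#         ∎

  -- Reconstruction in all arities

  reconstruct-coefficients : ∀ {k} → 2 ℕ.≤ k → q ℕ.< 2 ℕ.+ k → ∀ (a b : Fin (2 ℕ.+ k) → Carrier) → sum a ≡ sum b →
    (∀ φ → deckTotal a φ ≡ deckTotal b φ) → ∃ λ (τ : Permutation′ (2 ℕ.+ k)) → ∀ l → a l ≡ b (τ ⟨$⟩ʳ l)
  -- The arity is 2+k. From arity five on, the descent applies to the indicator of each element;
  -- arity four leaves q < 4, and the cases are told apart by whether 1+1 vanishes.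
  reconstruct-coefficients {k} 2≤k q<2+k a b same-sum same-deckTotal with ℕ.m≤n⇒m<n∨m≡n 2≤k
  ... | inj₁ 3≤k = occurrences⇒permutation _≟ᶠ_ a b λ x →
    Δ-vanishes +-comm a b same-deckTotal 3≤k (λ y → does (y ≟ᶠ x))
  ... | inj₂ refl with (1# + 1#) ≟ᶠ 0#
  ...   | yes 1+1≡0 = reconstruct-char-2 q<2+k 1+1≡0 a b same-sum same-deckTotal
  ...   | no 1+1≢0  = reconstruct-char-3 q<2+k 1+1≢0 a b same-sum same-deckTotal

  affine-reconstructible : ∀ {n} → 1 ℕ.≤ n → q ℕ.< 3 ℕ.+ n → (f : Fun Carrier Carrier (3 ℕ.+ n)) → Affine F f →
                           (g : Fun Carrier Carrier (3 ℕ.+ n)) → g ≈deck f → g ≋ f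
  affine-reconstructible {n} 1≤n q<N f (as , k , f≗) g g≈f =
    -- Every point has a repeated entry because the arity exceeds `q`, so the diagonals cover the
    -- space and `g` is affine.
    let b , d , g≗ = affine-from-diagonals (ℕ.s≤s (ℕ.s≤s (ℕ.s≤s 1≤n))) (g ∘ tabulate)
                       (g-affine-on-diagonals f g g≈f a k f-affine) (repetition q<N)
    in permuted⇒≋ f g g≈f a k f-affine b d g≗
         (reconstruct-coefficients (ℕ.s≤s 1≤n) q<N a b (same-sum f g g≈f a k f-affine b d g≗)
            (same-deckTotal f g g≈f a k f-affine b d g≗))
    where
    a : Fin (3 ℕ.+ n) → Carrier
    a = lookup as

    f-affine : ∀ x → f (tabulate x) ≡ a ∙ x + k
    f-affine x = trans (f≗ (tabulate x)) (cong (_+ k)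
      (trans (foldr-zipWith as (tabulate x)) (∙-congʳ′ a (lookup∘tabulate x))))

open import Data.Nat using (_+_; _⊔_; _≥_)

mainTheorem14 : ∀ {c} (q : ℕ) (F : FiniteField c q) (n : ℕ) → suc n ≥ (q ⊔ 3) + 1 →
    (f : Fun (FiniteField.Carrier F) (FiniteField.Carrier F) (suc n)) → Affine F f →
    (g : Fun (FiniteField.Carrier F) (FiniteField.Carrier F) (suc n)) → g ≈deck f → g ≋ f
mainTheorem14 q F n n≥ with subst (ℕ._≤ suc n) (ℕ.+-comm (q ⊔ 3) 1) n≥
... | ℕ.s≤s q⊔3≤n with ℕ.≤-trans (ℕ.m≤n⊔m q 3) q⊔3≤n
-- Peeling 3 ≤ n twice exhibits `n` as 2+m with 1 ≤ m, so the arity `suc n` has the form 3+m.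
... | ℕ.s≤s (ℕ.s≤s 1≤m) = affine-reconstructible F 1≤m (ℕ.s≤s (ℕ.≤-trans (ℕ.m≤m⊔n q 3) q⊔3≤n))
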